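{- Let $n \ge 4$ be an integer and let $\tau = \lfloor \frac{n}{2} \rfloor$. Then: 1. the graph $(C_n^{\tau})^c$ is singular if and only if $n$ is even or $n \equiv 3 \pmod 6$; 2. for every $i$ with $1 \le i < \tau$, the graph $(C_n^i)^c$ is singular if and only if $3 \mid n$ and $\gcd(i,n)$ divides $\frac{n}{3}$.
   Context: A graph is called singular if its adjacency matrix is singular. $C_n$ denotes the cycle graph on $n$ vertices. For $1 \le i \le \lfloor n/2 \rfloor$, $C_n^i$ is the graph on the vertex set of $C_n$ in which two vertices are adjacent exactly when their distance in $C_n$ equals $i$. The complement $X^c$ of a graph $X$ has the same vertex set, and two distinct vertices are adjacent in $X^c$ exactly when they are not adjacent in $X$ (no loops). -}

module Defs where

open import Algebra.Bundles using (CommutativeRing)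
open import Algebra.Definitions using (Invertible)
open import Data.Bool.Base using (if_then_else_)
open import Data.Fin.Base using (Fin; toℕ)
open import Data.Fin.Properties using (any?) renaming (_≟_ to _≟ᶠ_)
open import Data.Nat.Base using (ℕ; zero; suc; _≤_; _<_; z≤n; s≤s; ⌊_/2⌋)
open import Data.Nat.Properties using (_≟_; allUpTo?; ⌊n/2⌋-mono; ≤-trans)
open import Data.Product.Base using (_×_; _,_)
open import Data.Rational.Base using (ℚ; 0ℚ; 1ℚ; _*_)
open import Data.Rational.Properties using (+-*-commutativeRing)
open import Data.Sum.Base using (_⊎_; inj₁; inj₂; swap)
open import Data.Vec.Functional using (Vector)
open import Relation.Binary.Core using (Rel)
open import Relation.Binary.Definitions using (Decidable; Symmetric; Irreflexive)
open import Relation.Binary.PropositionalEquality using (_≡_; refl; sym; _≢_)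
open import Relation.Nullary.Decidable using (Dec; does; map′; ¬?; _×-dec_; _⊎-dec_)
open import Relation.Nullary.Negation using (¬_)
open import Level using (0ℓ)

open import Algebra.Properties.Semiring.Sum (CommutativeRing.semiring +-*-commutativeRing)
  using (sum)

Matrix : ℕ → Set
Matrix n = Vector (Vector ℚ n) n

infix 4 _≐_
_≐_ : ∀ {n} → Rel (Matrix n) 0ℓ
A ≐ B = ∀ i j → A i j ≡ B i j

infixl 7 _·_
_·_ : ∀ {n} → Matrix n → Matrix n → Matrix n
(A · B) i j = sum (λ k → A i k * B k j)

identity : ∀ {n} → Matrix n
identity i j = if does (i ≟ᶠ j) then 1ℚ else 0ℚ

-- A 0/1 matrix is invertible over ℚ exactly when it is invertible over any
-- larger field, such as ℝ or ℂ, so nothing is lost by working over ℚ.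
SingularMatrix : ∀ {n} → Matrix n → Set
SingularMatrix A = ¬ Invertible _≐_ identity _·_ A

record Graph (n : ℕ) : Set₁ where
  field
    _~_    : Rel (Fin n) 0ℓ
    _~?_   : Decidable _~_
    ~-sym  : Symmetric _~_
    ~-irr  : Irreflexive _≡_ _~_

adjacency : ∀ {n} → Graph n → Matrix n
adjacency G u v = if does (u ~? v) then 1ℚ else 0ℚ
  where open Graph G

Singular : ∀ {n} → Graph n → Set
Singular G = SingularMatrix (adjacency G)

complement : ∀ {n} → Graph n → Graph n
complement G = record
  { _~_   = λ u v → u ≢ v × ¬ (u ~ v)
  ; _~?_  = λ u v → ¬? (u ≟ᶠ v) ×-dec ¬? (u ~? v)
  ; ~-sym = λ (u≢v , u≁v) → (λ v≡u → u≢v (sym v≡u)) , λ v~u → u≁v (~-sym v~u)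
  ; ~-irr = λ u≡v (u≢v , _) → u≢v u≡v
  }
  where open Graph G

module _ {n : ℕ} (G : Graph n) where
  open Graph G

  infixr 5 _∷_
  data Walk : ℕ → Fin n → Fin n → Set where
    []  : ∀ {u} → Walk 0 u u
    _∷_ : ∀ {k u v w} → u ~ v → Walk k v w → Walk (suc k) u w

  walk? : ∀ k u v → Dec (Walk k u v)
  walk? zero    u v = map′ (λ { refl → [] }) (λ { [] → refl }) (u ≟ᶠ v)
  walk? (suc k) u v =
    map′ (λ (w , u~w , p) → u~w ∷ p) (λ { (u~w ∷ p) → _ , u~w , p })
         (any? (λ w → (u ~? w) ×-dec walk? k w v))

  snoc : ∀ {k u v w} → Walk k u v → v ~ w → Walk (suc k) u w
  snoc []        e = e ∷ []
  snoc (e′ ∷ p)  e = e′ ∷ snoc p e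

  reverse : ∀ {k u v} → Walk k u v → Walk k v u
  reverse []      = []
  reverse (e ∷ p) = snoc (reverse p) (~-sym e)

  -- "u and v are at distance d"; no d qualifies when they are not connected.
  Distance : ℕ → Rel (Fin n) 0ℓ
  Distance d u v = Walk d u v × (∀ {k} → k < d → ¬ Walk k u v)

  distance? : ∀ d → Decidable (Distance d)
  distance? d u v = walk? d u v ×-dec allUpTo? (λ k → ¬? (walk? k u v)) d

  distanceGraph : ∀ d → 1 ≤ d → Graph n
  distanceGraph d 1≤d = record
    { _~_   = Distance d
    ; _~?_  = distance? d
    ; ~-sym = λ (p , min) → reverse p , λ k<d q → min k<d (reverse q)
    ; ~-irr = λ { refl (_ , min) → min 1≤d [] }
    }

-- Successor along the cycle 0 → 1 → ⋯ → n-1 → 0.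
Next : ∀ {n} → Rel (Fin n) 0ℓ
Next {n} u v = toℕ v ≡ suc (toℕ u) ⊎ (suc (toℕ u) ≡ n × toℕ v ≡ 0)

next? : ∀ {n} → Decidable (Next {n})
next? {n} u v = (toℕ v ≟ suc (toℕ u)) ⊎-dec ((suc (toℕ u) ≟ n) ×-dec (toℕ v ≟ 0))

next-irr : ∀ {n} → 3 ≤ n → (u : Fin n) → ¬ Next u u
next-irr 3≤n u (inj₁ e) = m≢1+m (toℕ u) e
  where
  m≢1+m : ∀ m → m ≢ suc m
  m≢1+m _ ()
next-irr (s≤s (s≤s _)) u (inj₂ (e , e′)) with toℕ u
next-irr (s≤s (s≤s _)) u (inj₂ (() , refl)) | .0

cycle : ∀ n → 3 ≤ n → Graph n
cycle n 3≤n = record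
  { _~_   = λ u v → Next u v ⊎ Next v u
  ; _~?_  = λ u v → next? u v ⊎-dec next? v u
  ; ~-sym = swap
  ; ~-irr = λ { {u} refl (inj₁ e) → next-irr 3≤n u e
              ; {u} refl (inj₂ e) → next-irr 3≤n u e }
  }

cycleDistanceGraph : ∀ n i → 3 ≤ n → 1 ≤ i → Graph n
cycleDistanceGraph n i 3≤n 1≤i = distanceGraph (cycle n 3≤n) i 1≤i

4≤n⇒3≤n : ∀ {n} → 4 ≤ n → 3 ≤ n
4≤n⇒3≤n = ≤-trans (s≤s (s≤s (s≤s z≤n)))

4≤n⇒1≤⌊n/2⌋ : ∀ {n} → 4 ≤ n → 1 ≤ ⌊ n /2⌋
4≤n⇒1≤⌊n/2⌋ 4≤n = ≤-trans (s≤s z≤n) (⌊n/2⌋-mono 4≤n)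

{-# OPTIONS --safe #-}

-- The adjacency matrix of the complement is J - I - B, where B f = f ∘ σ + f ∘ σ⁻¹ for the shift σ by i
-- on ℤ/n, or B f = f ∘ σ when n = 2i. If σ has order m with 3 ∤ m, then I + σ + σ⁻¹ is inverted by an
-- explicit polynomial in σ, and correcting by a multiple of J inverts J - I - B. If 3 ∣ m, then 3d ∣ n for
-- d = gcd(i, n) and i ≡ ± d modulo 3d, so the difference of the indicators of 3dℤ and of 3dℤ - d lies in
-- the kernel. When n = 2i the difference of the indicators of two antipodal vertices does.
module Submission where

open import Defs
open import Data.Nat.Base using (ℕ; _≤_; _<_; ⌊_/2⌋; _/_; _%_)
open import Data.Nat.Divisibility using (_∣_)
open import Data.Nat.GCD using (gcd)
open import Data.Product.Base using (_×_)
open import Data.Sum.Base using (_⊎_)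
open import Function.Bundles using (_⇔_)
open import Relation.Binary.PropositionalEquality using (_≡_)

open import Algebra.Bundles using (CommutativeRing)
open import Algebra.Definitions using (Invertible)
open import Data.Bool.Base using (if_then_else_)
open import Data.Fin.Base using (Fin; zero; suc; toℕ; fromℕ<)
open import Data.Fin.Permutation using (permutation)
open import Data.Fin.Properties
  using (toℕ-injective; toℕ-fromℕ; toℕ-fromℕ<; toℕ-inject₁; toℕ<n) renaming (_≟_ to _≟ᶠ_)
import Data.Integer.Base as ℤ
open import Data.Nat.Base as ℕ using (zero; suc; z≤n; s≤s; _∸_)
open import Data.Nat.Divisibility
open import Data.Nat.DivMod using (m%n<n; m<n⇒m%n≡m; m∣n⇒o%n%m≡o%m; [m+n]%n≡m%n; [m+kn]%n≡m%n; %-distribˡ-+)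
open import Data.Nat.GCD using (gcd[m,n]∣m; gcd[m,n]∣n; gcd-greatest; gcd[m,n]≢0)
open import Data.Nat.GeneralisedArithmetic using (iterate)
import Data.Nat.Properties as ℕ
open import Data.Product.Base using (_,_; proj₁; proj₂; ∃; ∃₂)
open import Data.Sum.Base using (inj₁; inj₂; [_,_]; map₂)
open import Data.Vec.Functional using (Vector)
open import Function.Base using (_∘_; _$_)
open import Function.Bundles using (mk⇔; Equivalence)
open import Function.Construct.Composition using (_⇔-∘_)
open import Relation.Binary.PropositionalEquality
  using (_≢_; refl; sym; trans; cong; cong₂; subst; module ≡-Reasoning)
open import Relation.Nullary.Decidable
  using (Dec; yes; no; does; ¬?; _×-dec_; _→-dec_; dec-true; dec-false; decidable-stable; does-⇔; from-yes)
open import Relation.Nullary.Negation using (¬_; contradiction)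

open ≡-Reasoning

-- Over ℂ this is a question about eigenvalues: a shift of order m has the m-th roots of unity ω as
-- eigenvalues, and 1 + ω + ω⁻¹ vanishes exactly for primitive cube roots of unity, which occur
-- exactly when 3 divides m. Matrices here are rational, so diagonalisation gives way to a formula
-- for the inverse and to kernel vectors with entries 0, 1 and -1. As m = n / gcd(i, n), the two
-- conditions of the theorem merge into `3 * gcd i n ∣ n`. The summand J has to be controlled on
-- both sides. If f + B f = 0, summing all entries shows that the entries of f add up to 0, so J f =
-- 0 as well. For invertibility, J - I - B acts on constants as n - 3 in the generic case, which is
-- nonzero since 4 ≤ n. Singularity is the absence of a two-sided inverse, so a failure of
-- divisibility must produce an actual inverse; the divisibility itself then follows from its
-- decidability.

module _ where

  open import Data.Nat.Base using (_+_; _*_; NonZero)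
  open import Data.Nat.DivMod
    using (m%n%n≡m%n; m≡m%n+[m/n]*n; n%n≡0; %-remove-+ʳ)
  open import Data.Nat.Properties
    using ( _≟_; _<?_; allUpTo?; +-assoc; +-comm; +-identityʳ; +-suc; +-monoʳ-<; +-monoʳ-≤
          ; ∸-monoʳ-<; <⇒≢; <⇒≤; <-irrefl; <-trans; <-≤-trans; ≤-<-trans; ≤-antisym; ≤-refl; ≤-trans; ≮⇒≥
          ; m+[n∸m]≡n; m∸n+n≡m; m<m+n; m≤m+n; m≤n+m; n<1+n; n≢0⇒n>0)
  open import Data.Nat.Solver using (module +-*-Solver)
  open +-*-Solver using (solve; con; _:=_; _:+_; _:*_)

  -- Translations of ℤ/n.

  [m%n+o]%n≡[m+o]%n : ∀ m o n .{{_ : NonZero n}} → (m % n + o) % n ≡ (m + o) % n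
  [m%n+o]%n≡[m+o]%n m o n = begin
    (m % n + o) % n          ≡⟨ %-distribˡ-+ (m % n) o n ⟩
    (m % n % n + o % n) % n  ≡⟨ cong (λ x → (x + o % n) % n) (m%n%n≡m%n m n) ⟩
    (m % n + o % n) % n      ≡⟨ %-distribˡ-+ m o n ⟨
    (m + o) % n              ∎

  module _ {n} .{{_ : NonZero n}} where

    infixl 6 _⊕_
    -- The amount is a natural number so that multiples `t * i` and the inverse amount `n ∸ i` can
    -- be used directly.
    _⊕_ : Fin n → ℕ → Fin n
    u ⊕ a = fromℕ< (m%n<n (toℕ u + a) n)

    toℕ-⊕ : ∀ u a → toℕ (u ⊕ a) ≡ (toℕ u + a) % n
    toℕ-⊕ u a = toℕ-fromℕ< (m%n<n (toℕ u + a) n)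

    toℕ%n : ∀ u → toℕ {n} u % n ≡ toℕ u
    toℕ%n u = m<n⇒m%n≡m (toℕ<n u)

    ⊕-⊕ : ∀ u a b → u ⊕ a ⊕ b ≡ u ⊕ (a + b)
    ⊕-⊕ u a b = toℕ-injective $ begin
      toℕ (u ⊕ a ⊕ b)            ≡⟨ toℕ-⊕ (u ⊕ a) b ⟩
      (toℕ (u ⊕ a) + b) % n      ≡⟨ cong (λ x → (x + b) % n) (toℕ-⊕ u a) ⟩
      ((toℕ u + a) % n + b) % n  ≡⟨ [m%n+o]%n≡[m+o]%n (toℕ u + a) b n ⟩
      (toℕ u + a + b) % n        ≡⟨ cong (_% n) (+-assoc (toℕ u) a b) ⟩
      (toℕ u + (a + b)) % n      ≡⟨ toℕ-⊕ u (a + b) ⟨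
      toℕ (u ⊕ (a + b))          ∎

    ⊕-comm : ∀ u a b → u ⊕ a ⊕ b ≡ u ⊕ b ⊕ a
    ⊕-comm u a b = trans (⊕-⊕ u a b) (trans (cong (u ⊕_) (+-comm a b)) (sym (⊕-⊕ u b a)))

    ⊕-multiple : ∀ u {a} → n ∣ a → u ⊕ a ≡ u
    ⊕-multiple u {a} n∣a = toℕ-injective $ begin
      toℕ (u ⊕ a)      ≡⟨ toℕ-⊕ u a ⟩
      (toℕ u + a) % n  ≡⟨ %-remove-+ʳ (toℕ u) n∣a ⟩
      toℕ u % n        ≡⟨ toℕ%n u ⟩
      toℕ u            ∎

    ⊕-identityʳ : ∀ u → u ⊕ 0 ≡ u
    ⊕-identityʳ u = ⊕-multiple u (n ∣0)

    ⊕-+≡n : ∀ u {a b} → a + b ≡ n → u ⊕ a ⊕ b ≡ u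
    ⊕-+≡n u {a} {b} a+b≡n = trans (⊕-⊕ u a b) (⊕-multiple u (subst (n ∣_) (sym a+b≡n) ∣-refl))

    ⊕-cancelʳ : ∀ u v {a} → a ≤ n → u ⊕ a ≡ v ⊕ a → u ≡ v
    ⊕-cancelʳ u v {a} a≤n eq = begin
      u                ≡⟨ ⊕-+≡n u (m+[n∸m]≡n a≤n) ⟨
      u ⊕ a ⊕ (n ∸ a)  ≡⟨ cong (_⊕ (n ∸ a)) eq ⟩
      v ⊕ a ⊕ (n ∸ a)  ≡⟨ ⊕-+≡n v (m+[n∸m]≡n a≤n) ⟩
      v                ∎

    ⊕-cancelˡ : ∀ u {a b} → a < n → b < n → u ⊕ a ≡ u ⊕ b → a ≡ b
    ⊕-cancelˡ u {a} {b} a<n b<n eq = begin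
      a                             ≡⟨ back a<n ⟨
      (toℕ (u ⊕ a) + (n ∸ toℕ u)) % n  ≡⟨ cong (λ v → (toℕ v + (n ∸ toℕ u)) % n) eq ⟩
      (toℕ (u ⊕ b) + (n ∸ toℕ u)) % n  ≡⟨ back b<n ⟩
      b                             ∎
      where
      -- Adding `n ∸ toℕ u` completes the offset `toℕ u` to a full turn, so the residue that remains
      -- is `c` itself.
      back : ∀ {c} → c < n → (toℕ (u ⊕ c) + (n ∸ toℕ u)) % n ≡ c
      back {c} c<n = begin
        (toℕ (u ⊕ c) + (n ∸ toℕ u)) % n      ≡⟨ cong (λ x → (x + (n ∸ toℕ u)) % n) (toℕ-⊕ u c) ⟩
        ((toℕ u + c) % n + (n ∸ toℕ u)) % n  ≡⟨ [m%n+o]%n≡[m+o]%n (toℕ u + c) (n ∸ toℕ u) n ⟩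
        (toℕ u + c + (n ∸ toℕ u)) % n        ≡⟨ cong (λ x → (x + (n ∸ toℕ u)) % n) (+-comm (toℕ u) c) ⟩
        (c + toℕ u + (n ∸ toℕ u)) % n        ≡⟨ cong (_% n) (+-assoc c (toℕ u) (n ∸ toℕ u)) ⟩
        (c + (toℕ u + (n ∸ toℕ u))) % n      ≡⟨ cong (λ x → (c + x) % n) (m+[n∸m]≡n (<⇒≤ (toℕ<n u))) ⟩
        (c + n) % n                          ≡⟨ [m+n]%n≡m%n c n ⟩
        c % n                                ≡⟨ m<n⇒m%n≡m c<n ⟩
        c                                    ∎

    iterate-⊕ : ∀ i t u → iterate (_⊕ i) u t ≡ u ⊕ (t * i)
    iterate-⊕ i zero    u = sym (⊕-identityʳ u)
    iterate-⊕ i (suc t) u = trans (iterate-⊕ i t (u ⊕ i)) (⊕-⊕ u i (t * i))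

    next⇔⊕ : ∀ u v → Next u v ⇔ v ≡ u ⊕ 1
    next⇔⊕ u v = mk⇔ to from
      where
      toℕ-⊕1 : toℕ (u ⊕ 1) ≡ suc (toℕ u) % n
      toℕ-⊕1 = trans (toℕ-⊕ u 1) (cong (_% n) (+-comm (toℕ u) 1))

      to : Next u v → v ≡ u ⊕ 1
      to (inj₁ v≡1+u) = toℕ-injective $ begin
        toℕ v            ≡⟨ toℕ%n v ⟨
        toℕ v % n        ≡⟨ cong (_% n) v≡1+u ⟩
        suc (toℕ u) % n  ≡⟨ toℕ-⊕1 ⟨
        toℕ (u ⊕ 1)      ∎
      to (inj₂ (1+u≡n , v≡0)) = toℕ-injective $ begin
        toℕ v            ≡⟨ v≡0 ⟩
        0                ≡⟨ n%n≡0 n ⟨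
        n % n            ≡⟨ cong (_% n) 1+u≡n ⟨
        suc (toℕ u) % n  ≡⟨ toℕ-⊕1 ⟨
        toℕ (u ⊕ 1)      ∎

      from : v ≡ u ⊕ 1 → Next u v
      from refl with suc (toℕ u) <? n
      ... | yes 1+u<n = inj₁ (trans toℕ-⊕1 (m<n⇒m%n≡m 1+u<n))
      ... | no  1+u≮n = inj₂ (1+u≡n , trans toℕ-⊕1 (trans (cong (_% n) 1+u≡n) (n%n≡0 n)))
        where
        1+u≡n : suc (toℕ u) ≡ n
        1+u≡n = ≤-antisym (toℕ<n u) (≮⇒≥ 1+u≮n)

    -- Walks and distances in the cycle.

    append : ∀ (G : Graph n) {k l u v w} → Walk G k u v → Walk G l v w → Walk G (k + l) u w
    append G []      q = q
    append G (e ∷ p) q = e ∷ append G p q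

    module _ (3≤n : 3 ≤ n) where
      private C = cycle n 3≤n

      -- Here `a` counts the forward and `b` the backward steps; putting `b` on the side of `v`
      -- avoids subtraction.
      walk⇒shifts : ∀ {k u v} → Walk C k u v → ∃₂ λ a b → a + b ≡ k × v ⊕ b ≡ u ⊕ a
      walk⇒shifts [] = 0 , 0 , refl , refl
      walk⇒shifts {u = u} {v} (_∷_ {v = w} u~w p) with walk⇒shifts p | u~w
      ... | a , b , a+b≡k , v⊕b≡w⊕a | inj₁ next = suc a , b , cong suc a+b≡k , (begin
        v ⊕ b      ≡⟨ v⊕b≡w⊕a ⟩
        w ⊕ a      ≡⟨ cong (_⊕ a) (Equivalence.to (next⇔⊕ u w) next) ⟩
        u ⊕ 1 ⊕ a  ≡⟨ ⊕-⊕ u 1 a ⟩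
        u ⊕ suc a  ∎)
      ... | a , b , a+b≡k , v⊕b≡w⊕a | inj₂ next = a , suc b , trans (+-suc a b) (cong suc a+b≡k) , (begin
        v ⊕ suc b  ≡⟨ ⊕-⊕ v 1 b ⟨
        v ⊕ 1 ⊕ b  ≡⟨ ⊕-comm v 1 b ⟩
        v ⊕ b ⊕ 1  ≡⟨ cong (_⊕ 1) v⊕b≡w⊕a ⟩
        w ⊕ a ⊕ 1  ≡⟨ ⊕-comm w a 1 ⟩
        w ⊕ 1 ⊕ a  ≡⟨ cong (_⊕ a) (Equivalence.to (next⇔⊕ w u) next) ⟨
        u ⊕ a      ∎)

      shift-walk : ∀ a u → Walk C a u (u ⊕ a)
      shift-walk zero    u = subst (Walk C 0 u) (sym (⊕-identityʳ u)) []
      shift-walk (suc a) u = subst (Walk C (suc a) u) (⊕-⊕ u 1 a)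
        (inj₁ (Equivalence.from (next⇔⊕ u (u ⊕ 1)) refl) ∷ shift-walk a (u ⊕ 1))

      shifts⇒walk : ∀ a b {u v} → v ⊕ b ≡ u ⊕ a → Walk C (a + b) u v
      shifts⇒walk a b {u} {v} v⊕b≡u⊕a =
        append C (shift-walk a u) (subst (λ w → Walk C b w v) v⊕b≡u⊕a (reverse C (shift-walk b v)))

      -- A shortest walk never goes both ways: one forward and one backward step could be cancelled,
      -- leaving a walk with two steps fewer.
      distance⇒shift : ∀ {i u v} → Distance C i u v → u ⊕ i ≡ v ⊎ v ⊕ i ≡ u
      distance⇒shift {i} {u} {v} (p , minimal) with walk⇒shifts p
      ... | a , zero , refl , v≡u⊕a =
        inj₁ (trans (cong (u ⊕_) (+-identityʳ a)) (trans (sym v≡u⊕a) (⊕-identityʳ v)))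
      ... | zero , suc b , refl , v⊕b≡u = inj₂ (trans v⊕b≡u (⊕-identityʳ u))
      ... | suc a , suc b , refl , eq =
        contradiction (shifts⇒walk a b v⊕b≡u⊕a) (minimal (s≤s (+-monoʳ-≤ a (<⇒≤ (n<1+n b)))))
        where
        v⊕b≡u⊕a : v ⊕ b ≡ u ⊕ a
        v⊕b≡u⊕a = ⊕-cancelʳ (v ⊕ b) (u ⊕ a) (≤-trans (s≤s z≤n) 3≤n) $ begin
          v ⊕ b ⊕ 1  ≡⟨ trans (⊕-comm v b 1) (⊕-⊕ v 1 b) ⟩
          v ⊕ suc b  ≡⟨ eq ⟩
          u ⊕ suc a  ≡⟨ trans (⊕-comm u a 1) (⊕-⊕ u 1 a) ⟨
          u ⊕ a ⊕ 1  ∎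

      -- A walk of length `a + b < i` would make `i + b` and `a` equal modulo `n`. Both are below
      -- `n`, because `i + b < i + i ≤ n`, so they would be equal; but `a < i`.
      distance-⊕ : ∀ {i} → i + i ≤ n → ∀ u → Distance C i u (u ⊕ i)
      distance-⊕ {i} 2i≤n u = shift-walk i u , λ {k} k<i p → no-shorter k<i (walk⇒shifts p)
        where
        no-shorter : ∀ {k} → k < i → ¬ ∃₂ λ a b → a + b ≡ k × u ⊕ i ⊕ b ≡ u ⊕ a
        no-shorter k<i (a , b , refl , eq) =
          <⇒≢ a<i+b (sym (⊕-cancelˡ u i+b<n a<n (trans (sym (⊕-⊕ u i b)) eq)))
          where
          a<i+b : a < i + b
          a<i+b = <-≤-trans (≤-<-trans (m≤m+n a b) k<i) (m≤m+n i b)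

          i+b<n : i + b < n
          i+b<n = <-≤-trans (+-monoʳ-< i (≤-<-trans (m≤n+m b a) k<i)) 2i≤n

          a<n : a < n
          a<n = <-trans a<i+b i+b<n

      distance⇔shift : ∀ {i} → 1 ≤ i → i + i ≤ n → ∀ u v → Distance C i u v ⇔ (u ⊕ i ≡ v ⊎ v ⊕ i ≡ u)
      distance⇔shift {i} 1≤i 2i≤n u v = mk⇔ distance⇒shift λ
        { (inj₁ refl) → distance-⊕ 2i≤n u
        ; (inj₂ refl) → Graph.~-sym (distanceGraph C i 1≤i) (distance-⊕ 2i≤n v)
        }

      module _ {i} (1≤i : 1 ≤ i) (2i<n : i + i < n) where

        private
          i<n : i < n
          i<n = ≤-<-trans (m≤m+n i i) 2i<n

          i+[n∸i]≡n : i + (n ∸ i) ≡ n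
          i+[n∸i]≡n = m+[n∸m]≡n (<⇒≤ i<n)

        ⊕i⊕[n∸i] : ∀ u → u ⊕ i ⊕ (n ∸ i) ≡ u
        ⊕i⊕[n∸i] u = ⊕-+≡n u i+[n∸i]≡n

        ⊕[n∸i]⊕i : ∀ u → u ⊕ (n ∸ i) ⊕ i ≡ u
        ⊕[n∸i]⊕i u = trans (⊕-comm u (n ∸ i) i) (⊕i⊕[n∸i] u)

        distanceGraph-neighbours : ∀ u v → Distance C i u v ⇔ (u ⊕ i ≡ v ⊎ u ⊕ (n ∸ i) ≡ v)
        distanceGraph-neighbours u v = mk⇔
          (λ d → map₂ (λ { refl → ⊕i⊕[n∸i] v }) (Equivalence.to d⇔ d))
          (λ e → Equivalence.from d⇔ (map₂ (λ { refl → ⊕[n∸i]⊕i u }) e))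
          where d⇔ = distance⇔shift 1≤i (<⇒≤ 2i<n) u v

        -- Strictness of `i + i < n` enters here: at equality the two neighbours merge into the
        -- antipode.
        ⊕i≢⊕[n∸i] : ∀ u → u ⊕ i ≢ u ⊕ (n ∸ i)
        ⊕i≢⊕[n∸i] u eq = <⇒≢ 2i<n (trans (cong (i +_) i≡n∸i) i+[n∸i]≡n)
          where
          i≡n∸i : i ≡ n ∸ i
          i≡n∸i = ⊕-cancelˡ u i<n (∸-monoʳ-< 1≤i (<⇒≤ i<n)) eq

      distanceGraph-neighbour : ∀ {i} → 1 ≤ i → i + i ≡ n → ∀ u v → Distance C i u v ⇔ u ⊕ i ≡ v
      distanceGraph-neighbour {i} 1≤i refl u v = mk⇔
        (λ d → [ (λ e → e) , (λ { refl → ⊕-+≡n v refl }) ] (Equivalence.to d⇔ d))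
        (λ e → Equivalence.from d⇔ (inj₁ e))
        where d⇔ = distance⇔shift 1≤i ≤-refl u v

  -- Divisibility by 3 and the order of `i` in ℤ/n.

  ∣×∣/⇔*∣ : ∀ {m n o} .{{_ : NonZero m}} → (m ∣ n × o ∣ n / m) ⇔ m * o ∣ n
  ∣×∣/⇔*∣ {m} {n} {o} = mk⇔ (λ (m∣n , o∣n/m) → m∣n/o⇒o*m∣n m∣n o∣n/m)
                          (λ mo∣n → m*n∣⇒m∣ m o mo∣n , m*n∣o⇒n∣o/m m o mo∣n)

  mod-3 : ∀ a → ∃ λ q → a ≡ q * 3 ⊎ a ≡ 1 + q * 3 ⊎ a ≡ 2 + q * 3
  mod-3 a with a % 3 | m≡m%n+[m/n]*n a 3 | m%n<n a 3
  ... | 0 | eq | _ = a / 3 , inj₁ eq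
  ... | 1 | eq | _ = a / 3 , inj₂ (inj₁ eq)
  ... | 2 | eq | _ = a / 3 , inj₂ (inj₂ eq)
  ... | suc (suc (suc _)) | _ | s≤s (s≤s (s≤s ()))

  -- The order of i in ℤ/n is prime to 3, so it or its double is 2 modulo 3.
  ∃multiple≡2mod3 : ∀ {i n} → ¬ 3 * gcd i n ∣ n → ∃ λ q → n ∣ (2 + q * 3) * i
  ∃multiple≡2mod3 {i} {n} 3d∤n with gcd[m,n]∣m i n | gcd[m,n]∣n i n
  ... | divides a i≡a*d | divides m n≡m*d with mod-3 m
  ... | q , inj₁ refl = contradiction (divides q (trans n≡m*d
    (solve 2 (λ q d → q :* con 3 :* d := q :* (con 3 :* d)) refl q (gcd i n)))) 3d∤n
  ... | q , inj₂ (inj₁ refl) = q + q , divides (2 * a) (begin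
    (2 + (q + q) * 3) * i              ≡⟨ cong ((2 + (q + q) * 3) *_) i≡a*d ⟩
    (2 + (q + q) * 3) * (a * gcd i n)  ≡⟨ solve 3 (λ q a d → (con 2 :+ (q :+ q) :* con 3) :* (a :* d) :=
                                            con 2 :* a :* ((con 1 :+ q :* con 3) :* d)) refl q a (gcd i n) ⟩
    2 * a * ((1 + q * 3) * gcd i n)    ≡⟨ cong (2 * a *_) n≡m*d ⟨
    2 * a * n                          ∎)
  ... | q , inj₂ (inj₂ refl) = q , divides a (begin
    (2 + q * 3) * i              ≡⟨ cong ((2 + q * 3) *_) i≡a*d ⟩
    (2 + q * 3) * (a * gcd i n)  ≡⟨ solve 3 (λ m a d → m :* (a :* d) := a :* (m :* d)) refl (2 + q * 3) a (gcd i n) ⟩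
    a * ((2 + q * 3) * gcd i n)  ≡⟨ cong (a *_) n≡m*d ⟨
    a * n                        ∎)

  gcd>0 : ∀ i n .{{_ : NonZero n}} → 0 < gcd i n
  gcd>0 i n = n≢0⇒n>0 (gcd[m,n]≢0 i n (inj₂ (ℕ.≢-nonZero⁻¹ n)))

  -- With d the gcd and `i = a * d`, a multiple `a` of 3 would make `3 * d` a common divisor of `i`
  -- and `n`, hence a divisor of `d > 0`. The two remaining residues of `a` say that `i` is d or -d
  -- modulo 3d, the latter written as `d + d`.
  i≡±gcd : ∀ {i n} .{{_ : NonZero n}} → 3 * gcd i n ∣ n → ∃ λ r →
    i ≡ gcd i n + r * (3 * gcd i n) ⊎ i ≡ (gcd i n + gcd i n) + r * (3 * gcd i n)
  i≡±gcd {i} {n} 3d∣n with gcd[m,n]∣m i n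
  ... | divides a i≡a*d with mod-3 a
  ... | r , inj₂ (inj₁ refl) = r , inj₁ (trans i≡a*d
    (solve 2 (λ r d → (con 1 :+ r :* con 3) :* d := d :+ r :* (con 3 :* d)) refl r (gcd i n)))
  ... | r , inj₂ (inj₂ refl) = r , inj₂ (trans i≡a*d
    (solve 2 (λ r d → (con 2 :+ r :* con 3) :* d := (d :+ d) :+ r :* (con 3 :* d)) refl r (gcd i n)))
  ... | r , inj₁ refl = contradiction (<-≤-trans d<3d (∣⇒≤ 3d∣d)) (<-irrefl refl)
    where
    instance
      d-nonZero : NonZero (gcd i n)
      d-nonZero = ℕ.>-nonZero (gcd>0 i n)

    3d∣d : 3 * gcd i n ∣ gcd i n
    3d∣d = gcd-greatest (divides r (trans i≡a*d
      (solve 2 (λ r d → r :* con 3 :* d := r :* (con 3 :* d)) refl r (gcd i n)))) 3d∣n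

    d<3d : gcd i n < 3 * gcd i n
    d<3d = m<m+n (gcd i n) (<-≤-trans (gcd>0 i n) (m≤m+n (gcd i n) _))

  -- This is the congruence n - i ≡ -x ≡ y modulo e, made an equation in ℕ by adding multiples of e:
  -- r of them cancel those in `i`, and one more turns -x into e - x.
  complementary-shift : ∀ {n i x y e} k r → i ≤ n → n ≡ k * e → i ≡ x + r * e → x + y ≡ e →
    (n ∸ i) + (1 + r) * e ≡ y + k * e
  complementary-shift {n} {i} {x} {y} {e} k r i≤n n≡ke i≡x+re x+y≡e = begin
    (n ∸ i) + (e + r * e)        ≡⟨ cong (λ z → (n ∸ i) + (z + r * e)) x+y≡e ⟨
    (n ∸ i) + (x + y + r * e)    ≡⟨ solve 4 (λ m x y z → m :+ (x :+ y :+ z) := y :+ (m :+ (x :+ z))) refl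
                                      (n ∸ i) x y (r * e) ⟩
    y + ((n ∸ i) + (x + r * e))  ≡⟨ cong (λ z → y + ((n ∸ i) + z)) i≡x+re ⟨
    y + ((n ∸ i) + i)            ≡⟨ cong (y +_) (trans (m∸n+n≡m i≤n) n≡ke) ⟩
    y + k * e                    ∎

  gcd[h,1+h+h]∣1 : ∀ h → gcd h (1 + (h + h)) ∣ 1
  gcd[h,1+h+h]∣1 h = ∣m+n∣m⇒∣n
    (subst (d ∣_) (+-comm 1 (h + h)) (gcd[m,n]∣n h (1 + (h + h)))) (∣m∣n⇒∣m+n d∣h d∣h)
    where
    d : ℕ
    d = gcd h (1 + (h + h))

    d∣h : d ∣ h
    d∣h = gcd[m,n]∣m h (1 + (h + h))

  odd⇒3∣n⇔n%6≡3 : ∀ n → ¬ 2 ∣ n → 3 ∣ n ⇔ n % 6 ≡ 3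
  odd⇒3∣n⇔n%6≡3 n 2∤n = mk⇔
    (λ 3∣n → residue (m%n<n n 6) (%-presˡ-∣ 3∣n (divides 2 refl)) (2∤n ∘ ∣n∣m%n⇒∣m (divides 3 refl)))
    (λ n%6≡3 → ∣n∣m%n⇒∣m (divides 2 refl) (subst (3 ∣_) (sym n%6≡3) ∣-refl))
    where
    residue : ∀ {r} → r < 6 → 3 ∣ r → ¬ 2 ∣ r → r ≡ 3
    residue = from-yes (allUpTo? (λ r → (3 ∣? r) →-dec (¬? (2 ∣? r) →-dec (r ≟ 3))) 6)

-- Rational matrices acting on vectors: inverses and kernels.

open import Data.Rational.Base as ℚ using (ℚ; 0ℚ; 1ℚ; ½; _+_; _*_; -_; _-_; 1/_; NonNegative)
open import Data.Rational.Properties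
  using ( +-*-commutativeRing; +-comm; +-identityˡ; +-identityʳ; *-assoc; *-comm; *-identityˡ; *-identityʳ
        ; *-inverseʳ; *-zeroˡ; *-zeroʳ; nonNeg+nonNeg⇒nonNeg; pos+nonNeg⇒pos; pos⇒nonZero)
open import Data.Rational.Solver using (module +-*-Solver)
open import Algebra.Properties.Semiring.Sum (CommutativeRing.semiring +-*-commutativeRing)
open +-*-Solver using (solve; con; _:=_; _:+_; _:*_; :-_; _:-_)

⅓ : ℚ
⅓ = ℤ.+ 1 ℚ./ 3

indicator : ∀ {p} {P : Set p} → Dec P → ℚ
indicator P? = if does P? then 1ℚ else 0ℚ

indicator-⇔ : ∀ {p q} {P : Set p} {Q : Set q} → P ⇔ Q → (P? : Dec P) (Q? : Dec Q) →
  indicator P? ≡ indicator Q?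
indicator-⇔ P⇔Q P? Q? = cong (if_then 1ℚ else 0ℚ) (does-⇔ P⇔Q P? Q?)

-- One entry of Ā + I + A = J, where Ā belongs to the complement: `P` is equality of two vertices,
-- `Q` is adjacency, and they exclude each other by irreflexivity.
indicator-complement : ∀ {p q} {P : Set p} {Q : Set q} (P? : Dec P) (Q? : Dec Q) → ¬ (P × Q) →
  indicator (¬? P? ×-dec ¬? Q?) + (indicator P? + indicator Q?) ≡ 1ℚ
indicator-complement (yes p) (yes q) ¬pq = contradiction (p , q) ¬pq
indicator-complement (yes _) (no _)  _   = refl
indicator-complement (no _)  (yes _) _   = refl
indicator-complement (no _)  (no _)  _   = refl

indicator-⊎ : ∀ {p q r} {P : Set p} {Q : Set q} {R : Set r} → P ⇔ (Q ⊎ R) → ¬ (Q × R) →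
  (P? : Dec P) (Q? : Dec Q) (R? : Dec R) → indicator P? ≡ indicator Q? + indicator R?
indicator-⊎ _   ¬qr _       (yes q) (yes r) = contradiction (q , r) ¬qr
indicator-⊎ _   _   (yes _) (yes _) (no _)  = refl
indicator-⊎ _   _   (yes _) (no _)  (yes _) = refl
indicator-⊎ P⇔  _   (no ¬p) (yes q) (no _)  = contradiction (Equivalence.from P⇔ (inj₁ q)) ¬p
indicator-⊎ P⇔  _   (no ¬p) (no _)  (yes r) = contradiction (Equivalence.from P⇔ (inj₂ r)) ¬p
indicator-⊎ P⇔  _   (yes p) (no ¬q) (no ¬r) = contradiction (Equivalence.to P⇔ p) [ ¬q , ¬r ]
indicator-⊎ _   _   (no _)  (no _)  (no _)  = refl

infixr 7 _⊛_
_⊛_ : ∀ {n} → Matrix n → Vector ℚ n → Vector ℚ n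
(A ⊛ f) u = sum (λ v → A u v * f v)

-- Associativity (xA)y = x(Ay). The row `x` is an arbitrary vector, so that it can be a row of a
-- matrix or, for the transpose, a column.
*-sum-swap : ∀ {m n} (x : Vector ℚ m) (A : Fin m → Fin n → ℚ) (y : Vector ℚ n) →
  sum (λ v → sum (λ k → x k * A k v) * y v) ≡ sum (λ k → x k * sum (λ v → A k v * y v))
*-sum-swap x A y = begin
  sum (λ v → sum (λ k → x k * A k v) * y v)    ≡⟨ sum-cong-≗ (λ v → *-distribʳ-sum (y v) (λ k → x k * A k v)) ⟩
  sum (λ v → sum (λ k → x k * A k v * y v))    ≡⟨ ∑-comm (λ v k → x k * A k v * y v) ⟩
  sum (λ k → sum (λ v → x k * A k v * y v))    ≡⟨ sum-cong-≗ (λ k → sum-cong-≗ (λ v → *-assoc (x k) (A k v) (y v))) ⟩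
  sum (λ k → sum (λ v → x k * (A k v * y v)))  ≡⟨ sum-cong-≗ (λ k → *-distribˡ-sum (x k) (λ v → A k v * y v)) ⟨
  sum (λ k → x k * sum (λ v → A k v * y v))    ∎

identity-suc : ∀ {n} (i j : Fin n) → identity (suc i) (suc j) ≡ identity i j
identity-suc i j = indicator-⇔ (mk⇔ (λ { refl → refl }) (cong suc)) (suc i ≟ᶠ suc j) (i ≟ᶠ j)

identity-sym : ∀ {n} (i j : Fin n) → identity i j ≡ identity j i
identity-sym i j = indicator-⇔ (mk⇔ sym sym) (i ≟ᶠ j) (j ≟ᶠ i)

identity-⊛ : ∀ {n} (f : Vector ℚ n) u → (identity ⊛ f) u ≡ f u
identity-⊛ {suc n} f zero = begin
  1ℚ * f zero + sum (λ v → 0ℚ * f (suc v))  ≡⟨ cong₂ _+_ (*-identityˡ (f zero))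
                                                 (sum-cong-≗ (λ v → *-zeroˡ (f (suc v)))) ⟩
  f zero + sum {n} (λ _ → 0ℚ)               ≡⟨ cong (f zero +_) (sum-replicate-zero n) ⟩
  f zero + 0ℚ                               ≡⟨ +-identityʳ (f zero) ⟩
  f zero                                    ∎
identity-⊛ {suc n} f (suc u) = begin
  0ℚ * f zero + sum (λ v → identity (suc u) (suc v) * f (suc v))
    ≡⟨ cong₂ _+_ (*-zeroˡ (f zero)) (sum-cong-≗ (λ v → cong (_* f (suc v)) (identity-suc u v))) ⟩
  0ℚ + (identity ⊛ (f ∘ suc)) u
    ≡⟨ +-identityˡ _ ⟩
  (identity ⊛ (f ∘ suc)) u
    ≡⟨ identity-⊛ (f ∘ suc) u ⟩
  f (suc u) ∎

kernel⇒singular : ∀ {n} (A : Matrix n) (f : Vector ℚ n) u →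
  (∀ v → (A ⊛ f) v ≡ 0ℚ) → f u ≢ 0ℚ → SingularMatrix A
kernel⇒singular {n} A f u Af≡0 fu≢0 (X , XA≐I , _) = fu≢0 $ begin
  f u                            ≡⟨ identity-⊛ f u ⟨
  (identity ⊛ f) u               ≡⟨ sum-cong-≗ (λ v → cong (_* f v) (XA≐I u v)) ⟨
  ((X · A) ⊛ f) u                ≡⟨ *-sum-swap (X u) A f ⟩
  (X ⊛ (A ⊛ f)) u                ≡⟨ sum-cong-≗ (λ k → trans (cong (X u k *_) (Af≡0 k)) (*-zeroʳ (X u k))) ⟩
  sum {n} (λ _ → 0ℚ)             ≡⟨ sum-replicate-zero n ⟩
  0ℚ                             ∎

-- A right inverse X of a symmetric A satisfies Xᵀ = Xᵀ A X = X, so it is a left inverse too.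
symmetric-solvable⇒invertible : ∀ {n} (A : Matrix n) → (∀ u v → A u v ≡ A v u) →
  (∀ j → ∃ λ f → ∀ u → (A ⊛ f) u ≡ identity u j) → Invertible _≐_ identity _·_ A
symmetric-solvable⇒invertible {n} A A-sym solution = X , XA≐I , AX≐I
  where
  X : Matrix n
  X u j = proj₁ (solution j) u

  AX≐I : A · X ≐ identity
  AX≐I u j = proj₂ (solution j) u

  XᵀA≐I : ∀ i j → sum (λ k → X k i * A k j) ≡ identity i j
  XᵀA≐I i j = begin
    sum (λ k → X k i * A k j)  ≡⟨ sum-cong-≗ (λ k → trans (*-comm (X k i) (A k j)) (cong (_* X k i) (A-sym k j))) ⟩
    (A · X) j i                ≡⟨ AX≐I j i ⟩
    identity j i               ≡⟨ identity-sym j i ⟩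
    identity i j               ∎

  X-sym : ∀ i j → X i j ≡ X j i
  X-sym i j = begin
    X i j                                               ≡⟨ identity-⊛ (λ k → X k j) i ⟨
    sum (λ k → identity i k * X k j)                    ≡⟨ sum-cong-≗ (λ k → cong (_* X k j) (XᵀA≐I i k)) ⟨
    sum (λ k → sum (λ l → X l i * A l k) * X k j)       ≡⟨ *-sum-swap (λ l → X l i) A (λ k → X k j) ⟩
    sum (λ l → X l i * (A · X) l j)                     ≡⟨ sum-cong-≗ (λ l →
                                                             cong (X l i *_) (trans (AX≐I l j) (identity-sym l j))) ⟩
    sum (λ l → X l i * identity j l)                    ≡⟨ sum-cong-≗ (λ l → *-comm (X l i) (identity j l)) ⟩
    sum (λ l → identity j l * X l i)                    ≡⟨ identity-⊛ (λ l → X l i) j ⟩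
    X j i                                               ∎

  XA≐I : X · A ≐ identity
  XA≐I i j = trans (sum-cong-≗ (λ k → cong (_* A k j) (X-sym i k))) (XᵀA≐I i j)

-- Adjacency matrices acting on vectors.

module _ {n} (G : Graph n) where
  open Graph G

  adjacency-sym : ∀ u v → adjacency G u v ≡ adjacency G v u
  adjacency-sym u v = indicator-⇔ (mk⇔ ~-sym ~-sym) (u ~? v) (v ~? u)

  -- Ā + I + A = J applied to `f`: each entry of J f is `sum f`.
  complement-⊛ : ∀ f u → (adjacency (complement G) ⊛ f) u + (f u + (adjacency G ⊛ f) u) ≡ sum f
  complement-⊛ f u = begin
    (Ā ⊛ f) u + (f u + (A ⊛ f) u)
      ≡⟨ cong (λ x → (Ā ⊛ f) u + (x + (A ⊛ f) u)) (identity-⊛ f u) ⟨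
    (Ā ⊛ f) u + ((identity ⊛ f) u + (A ⊛ f) u)
      ≡⟨ cong ((Ā ⊛ f) u +_) (∑-distrib-+ (λ v → identity u v * f v) (λ v → A u v * f v)) ⟨
    (Ā ⊛ f) u + sum (λ v → identity u v * f v + A u v * f v)
      ≡⟨ ∑-distrib-+ (λ v → Ā u v * f v) (λ v → identity u v * f v + A u v * f v) ⟨
    sum (λ v → Ā u v * f v + (identity u v * f v + A u v * f v))
      ≡⟨ sum-cong-≗ (λ v → collect (Ā u v) (identity u v) (A u v) (f v)) ⟩
    sum (λ v → (Ā u v + (identity u v + A u v)) * f v)
      ≡⟨ sum-cong-≗ (λ v → cong (_* f v)
           (indicator-complement (u ≟ᶠ v) (u ~? v) (λ (u≡v , u~v) → ~-irr u≡v u~v))) ⟩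
    sum (λ v → 1ℚ * f v)
      ≡⟨ sum-cong-≗ (λ v → *-identityˡ (f v)) ⟩
    sum f ∎
    where
    A Ā : Matrix n
    A = adjacency G
    Ā = adjacency (complement G)

    collect : ∀ a b c x → a * x + (b * x + c * x) ≡ (a + (b + c)) * x
    collect = solve 4 (λ a b c x → a :* x :+ (b :* x :+ c :* x) := (a :+ (b :+ c)) :* x) refl

  one-neighbour-⊛ : ∀ f u w → (∀ v → u ~ v ⇔ w ≡ v) → (adjacency G ⊛ f) u ≡ f w
  one-neighbour-⊛ f u w ~⇔ = begin
    (adjacency G ⊛ f) u  ≡⟨ sum-cong-≗ (λ v → cong (_* f v) (indicator-⇔ (~⇔ v) (u ~? v) (w ≟ᶠ v))) ⟩
    (identity ⊛ f) w     ≡⟨ identity-⊛ f w ⟩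
    f w                  ∎

  two-neighbours-⊛ : ∀ f u w w′ → w ≢ w′ → (∀ v → u ~ v ⇔ (w ≡ v ⊎ w′ ≡ v)) →
    (adjacency G ⊛ f) u ≡ f w + f w′
  two-neighbours-⊛ f u w w′ w≢w′ ~⇔ = begin
    (adjacency G ⊛ f) u
      ≡⟨ sum-cong-≗ (λ v → cong (_* f v) (indicator-⊎ (~⇔ v) (λ (e , e′) → w≢w′ (trans e (sym e′)))
           (u ~? v) (w ≟ᶠ v) (w′ ≟ᶠ v))) ⟩
    sum (λ v → (identity w v + identity w′ v) * f v)
      ≡⟨ sum-cong-≗ (λ v → solve 3 (λ a b x → (a :+ b) :* x := a :* x :+ b :* x) refl
           (identity w v) (identity w′ v) (f v)) ⟩
    sum (λ v → identity w v * f v + identity w′ v * f v)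
      ≡⟨ ∑-distrib-+ (λ v → identity w v * f v) (λ v → identity w′ v * f v) ⟩
    (identity ⊛ f) w + (identity ⊛ f) w′
      ≡⟨ cong₂ _+_ (identity-⊛ f w) (identity-⊛ f w′) ⟩
    f w + f w′ ∎

-- Solving the three-term equation and the complement system.

∑< : ℕ → (ℕ → ℚ) → ℚ
∑< k h = sum {k} (h ∘ toℕ)

∑<-last : ∀ k h → ∑< (suc k) h ≡ ∑< k h + h k
∑<-last k h = trans (sum-init-last {k} (λ t → h (toℕ t)))
  (cong₂ _+_ (sum-cong-≗ {k} (λ t → cong h (toℕ-inject₁ t))) (cong h (toℕ-fromℕ k)))

∑<-thirds : ∀ q (h : ℕ → ℚ) →
  ∑< q (λ t → h (t ℕ.* 3)) + (∑< q (λ t → h (1 ℕ.+ t ℕ.* 3)) + ∑< q (λ t → h (2 ℕ.+ t ℕ.* 3))) ≡ ∑< (q ℕ.* 3) h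
∑<-thirds zero    h = refl
∑<-thirds (suc q) h = begin
  (h 0 + a) + ((h 1 + b) + (h 2 + c))    ≡⟨ solve 6 (λ x y z a b c →
                                              (x :+ a) :+ ((y :+ b) :+ (z :+ c)) :=
                                              x :+ (y :+ (z :+ (a :+ (b :+ c))))) refl (h 0) (h 1) (h 2) a b c ⟩
  h 0 + (h 1 + (h 2 + (a + (b + c))))    ≡⟨ cong (λ x → h 0 + (h 1 + (h 2 + x))) (∑<-thirds q h₃) ⟩
  h 0 + (h 1 + (h 2 + ∑< (q ℕ.* 3) h₃))  ∎
  where
  h₃ : ℕ → ℚ
  h₃ t = h (3 ℕ.+ t)

  a b c : ℚ
  a = ∑< q (λ t → h₃ (t ℕ.* 3))
  b = ∑< q (λ t → h₃ (1 ℕ.+ t ℕ.* 3))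
  c = ∑< q (λ t → h₃ (2 ℕ.+ t ℕ.* 3))

-- In ℚ[σ]/(σ^M - 1) with M = 3q+2 and norm N = 1 + σ + ⋯ + σ^(M-1), the identities
-- (σ⁻¹ + 1 + σ)(σ + σ⁴ + ⋯ + σ^(3q+1)) = N + 1 and (σ⁻¹ + 1 + σ) N = 3 N show that
-- σ + σ⁴ + ⋯ + σ^(3q+1) - N/3 is the inverse of σ⁻¹ + 1 + σ.
three-term-solvable : ∀ {x} {X : Set x} (σ σ⁻¹ : X → X) → (∀ u → σ (σ⁻¹ u) ≡ u) →
  ∀ q → (∀ u → iterate σ u (2 ℕ.+ q ℕ.* 3) ≡ u) →
  (g : X → ℚ) → ∃ λ f → ∀ u → f u + (f (σ u) + f (σ⁻¹ u)) ≡ g u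
three-term-solvable {X = X} σ σ⁻¹ σσ⁻¹ q σ^M g = f , solves
  where
  M : ℕ
  M = 2 ℕ.+ q ℕ.* 3

  orbit : X → ℕ → ℚ
  orbit u t = g (iterate σ u t)

  third : ℕ → X → ℚ
  -- With `suc q` terms each, the three residue classes cover `suc M` exponents, one more than `N`.
  -- The surplus exponent `M` contributes `g u`, because σ^M is the identity; this is the 1 in N +
  -- 1.
  third r u = ∑< (suc q) (λ t → orbit u (r ℕ.+ t ℕ.* 3))

  N f : X → ℚ
  N u = ∑< M (orbit u)
  f u = third 1 u - ⅓ * N u

  thirds : ∀ u → third 0 u + (third 1 u + third 2 u) ≡ N u + g u
  thirds u = begin
    third 0 u + (third 1 u + third 2 u)  ≡⟨ ∑<-thirds (suc q) (orbit u) ⟩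
    ∑< (suc M) (orbit u)                 ≡⟨ ∑<-last M (orbit u) ⟩
    N u + orbit u M                      ≡⟨ cong (λ v → N u + g v) (σ^M u) ⟩
    N u + g u                            ∎

  N-σ : ∀ u → N (σ u) ≡ N u
  N-σ u = begin
    N (σ u)                     ≡⟨ solve 2 (λ a b → b := (a :+ b) :- a) refl (g u) (N (σ u)) ⟩
    -- `iterate` applies `σ` first, so `g u + N (σ u)` is by computation the orbit sum of `u` over
    -- `suc M` terms; it is now split at its last term instead.
    (g u + N (σ u)) - g u       ≡⟨ cong (_- g u) (∑<-last M (orbit u)) ⟩
    (N u + orbit u M) - g u     ≡⟨ cong (λ v → (N u + g v) - g u) (σ^M u) ⟩
    (N u + g u) - g u           ≡⟨ solve 2 (λ a b → (b :+ a) :- a := b) refl (g u) (N u) ⟩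
    N u                         ∎

  N-σ⁻¹ : ∀ u → N (σ⁻¹ u) ≡ N u
  N-σ⁻¹ u = trans (sym (N-σ (σ⁻¹ u))) (cong N (σσ⁻¹ u))

  f-σ : ∀ u → f (σ u) ≡ third 2 u - ⅓ * N u
  f-σ u = cong (λ x → third 2 u - ⅓ * x) (N-σ u)

  f-σ⁻¹ : ∀ u → f (σ⁻¹ u) ≡ third 0 u - ⅓ * N u
  -- By computation `third 1 (σ⁻¹ u)` is `third 0 (σ (σ⁻¹ u))`.
  f-σ⁻¹ u = cong₂ (λ x y → x - ⅓ * y) (cong (third 0) (σσ⁻¹ u)) (N-σ⁻¹ u)

  solves : ∀ u → f u + (f (σ u) + f (σ⁻¹ u)) ≡ g u
  solves u = begin
    f u + (f (σ u) + f (σ⁻¹ u))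
      ≡⟨ cong₂ (λ x y → f u + (x + y)) (f-σ u) (f-σ⁻¹ u) ⟩
    (third 1 u - ⅓ * N u) + ((third 2 u - ⅓ * N u) + (third 0 u - ⅓ * N u))
      ≡⟨ solve 4 (λ a b c n → (b :- con ⅓ :* n) :+ ((c :- con ⅓ :* n) :+ (a :- con ⅓ :* n)) :=
           (a :+ (b :+ c)) :- n) refl (third 0 u) (third 1 u) (third 2 u) (N u) ⟩
    (third 0 u + (third 1 u + third 2 u)) - N u
      ≡⟨ cong (_- N u) (thirds u) ⟩
    (N u + g u) - N u
      ≡⟨ solve 2 (λ n x → (n :+ x) :- n := x) refl (N u) (g u) ⟩
    g u ∎

nonNegative-sum-1 : ∀ n → NonNegative (sum {n} (λ _ → 1ℚ))
nonNegative-sum-1 zero    = _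
nonNegative-sum-1 (suc n) = nonNeg+nonNeg⇒nonNeg 1ℚ (sum {n} (λ _ → 1ℚ)) {{nonNegative-sum-1 n}}

-- Adding the constant a to f adds (n - 3) a to J f - f - f ∘ σ - f ∘ σ⁻¹, and n - 3 is nonzero.
complement-solvable : ∀ {n} → 4 ℕ.≤ n → (A : Matrix n) (σ σ⁻¹ : Fin n → Fin n) →
  (∀ f u → (A ⊛ f) u + (f u + (f (σ u) + f (σ⁻¹ u))) ≡ sum f) →
  (∀ (g : Vector ℚ n) → ∃ λ (f : Vector ℚ n) → ∀ u → f u + (f (σ u) + f (σ⁻¹ u)) ≡ g u) →
  ∀ (g : Vector ℚ n) → ∃ λ (f : Vector ℚ n) → ∀ u → (A ⊛ f) u ≡ g u
complement-solvable {suc (suc (suc (suc k)))} (s≤s (s≤s (s≤s (s≤s z≤n)))) A σ σ⁻¹ rows solvable g = f , solves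
  where
  n = 4 ℕ.+ k

  D : Fin n → ℚ
  D = proj₁ (solvable (-_ ∘ g))

  r : ℚ
  -- This is n - 3 as a rational; a sum over `Fin n` splits off the other three terms by
  -- computation.
  r = sum {suc k} (λ _ → 1ℚ)

  instance
    r-nonZero : ℚ.NonZero r
    r-nonZero = pos⇒nonZero r {{pos+nonNeg⇒pos 1ℚ (sum {k} (λ _ → 1ℚ)) {{nonNegative-sum-1 k}}}}

  a : ℚ
  -- Since `D` solves the equation for `- g`, applying `A` to `a + D` gives (n - 3) a + `sum D` + g,
  -- and this `a` cancels the first two terms.
  a = - sum D * 1/ r

  f : Fin n → ℚ
  f u = a + D u

  sum-const : sum {n} (λ _ → a) ≡ a + (a + (a + - sum D))
  sum-const = cong (λ x → a + (a + (a + x))) $ begin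
    sum {suc k} (λ _ → a)        ≡⟨ sum-cong-≗ {suc k} (λ _ → *-identityʳ a) ⟨
    sum {suc k} (λ _ → a * 1ℚ)   ≡⟨ *-distribˡ-sum {suc k} a (λ _ → 1ℚ) ⟨
    - sum D * 1/ r * r           ≡⟨ solve 3 (λ s i r → s :* i :* r := s :* (r :* i)) refl (- sum D) (1/ r) r ⟩
    - sum D * (r * 1/ r)         ≡⟨ cong (- sum D *_) (*-inverseʳ r) ⟩
    - sum D * 1ℚ                 ≡⟨ *-identityʳ (- sum D) ⟩
    - sum D                      ∎

  sum-f : sum f ≡ a + (a + a)
  sum-f = begin
    sum f                                     ≡⟨ ∑-distrib-+ (λ _ → a) D ⟩
    sum {n} (λ _ → a) + sum D                 ≡⟨ cong (_+ sum D) sum-const ⟩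
    a + (a + (a + - sum D)) + sum D           ≡⟨ solve 2 (λ a s → a :+ (a :+ (a :+ :- s)) :+ s := a :+ (a :+ a))
                                                   refl a (sum D) ⟩
    a + (a + a)                               ∎

  solves : ∀ u → (A ⊛ f) u ≡ g u
  solves u = begin
    (A ⊛ f) u
      ≡⟨ solve 5 (λ z a x y w → z := (z :+ ((a :+ x) :+ ((a :+ y) :+ (a :+ w)))) :- (a :+ (a :+ a)) :- (x :+ (y :+ w)))
           refl ((A ⊛ f) u) a (D u) (D (σ u)) (D (σ⁻¹ u)) ⟩
    ((A ⊛ f) u + (f u + (f (σ u) + f (σ⁻¹ u)))) - (a + (a + a)) - (D u + (D (σ u) + D (σ⁻¹ u)))
      ≡⟨ cong₂ (λ x y → x - (a + (a + a)) - y) (trans (rows f u) sum-f) (proj₂ (solvable (-_ ∘ g)) u) ⟩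
    (a + (a + a)) - (a + (a + a)) - - g u
      ≡⟨ solve 2 (λ a g → a :- a :- (:- g) := g) refl (a + (a + a)) (g u) ⟩
    g u ∎

-- Kernel vectors and their vanishing sums.

module _ {n} (σ σ⁻¹ : Fin n → Fin n) (σσ⁻¹ : ∀ u → σ (σ⁻¹ u) ≡ u) (σ⁻¹σ : ∀ u → σ⁻¹ (σ u) ≡ u)
         (f : Vector ℚ n) where

  sum-∘ : sum (f ∘ σ) ≡ sum f
  sum-∘ = sym (sum-permute f (permutation σ σ⁻¹ σσ⁻¹ σ⁻¹σ))

  -- Summing over all `u` counts `sum f` twice, as `σ` is a permutation. This removes the J term
  -- when `f` is tested as a kernel vector.
  two-term⇒sum≡0 : (∀ u → f u + f (σ u) ≡ 0ℚ) → sum f ≡ 0ℚ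
  two-term⇒sum≡0 two-term = begin
    sum f                               ≡⟨ solve 1 (λ s → s := con ½ :* (s :+ s)) refl (sum f) ⟩
    ½ * (sum f + sum f)                 ≡⟨ cong (λ s → ½ * (sum f + s)) sum-∘ ⟨
    ½ * (sum f + sum (f ∘ σ))           ≡⟨ cong (½ *_) (∑-distrib-+ f (f ∘ σ)) ⟨
    ½ * sum (λ u → f u + f (σ u))       ≡⟨ cong (½ *_) (sum-cong-≗ two-term) ⟩
    ½ * sum {n} (λ _ → 0ℚ)              ≡⟨ cong (½ *_) (sum-replicate-zero n) ⟩
    ½ * 0ℚ                              ≡⟨⟩
    0ℚ                                  ∎

module _ {n} (σ σ⁻¹ : Fin n → Fin n) (σσ⁻¹ : ∀ u → σ (σ⁻¹ u) ≡ u) (σ⁻¹σ : ∀ u → σ⁻¹ (σ u) ≡ u)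
         (f : Vector ℚ n) where

  three-term⇒sum≡0 : (∀ u → f u + (f (σ u) + f (σ⁻¹ u)) ≡ 0ℚ) → sum f ≡ 0ℚ
  three-term⇒sum≡0 three-term = begin
    sum f
      ≡⟨ solve 1 (λ s → s := con ⅓ :* (s :+ (s :+ s))) refl (sum f) ⟩
    ⅓ * (sum f + (sum f + sum f))
      ≡⟨ cong₂ (λ s t → ⅓ * (sum f + (s + t))) (sum-∘ σ σ⁻¹ σσ⁻¹ σ⁻¹σ f) (sum-∘ σ⁻¹ σ σ⁻¹σ σσ⁻¹ f) ⟨
    ⅓ * (sum f + (sum (f ∘ σ) + sum (f ∘ σ⁻¹)))
      ≡⟨ cong (λ s → ⅓ * (sum f + s)) (∑-distrib-+ (f ∘ σ) (f ∘ σ⁻¹)) ⟨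
    ⅓ * (sum f + sum (λ u → f (σ u) + f (σ⁻¹ u)))
      ≡⟨ cong (⅓ *_) (∑-distrib-+ f (λ u → f (σ u) + f (σ⁻¹ u))) ⟨
    ⅓ * sum (λ u → f u + (f (σ u) + f (σ⁻¹ u)))
      ≡⟨ cong (⅓ *_) (sum-cong-≗ three-term) ⟩
    ⅓ * sum {n} (λ _ → 0ℚ)
      ≡⟨ cong (⅓ *_) (sum-replicate-zero n) ⟩
    ⅓ * 0ℚ ≡⟨⟩
    0ℚ ∎

-- Translates of the e-periodic function wave by multiples of d telescope; the kernel vectors are
-- wave with e = 3d and with e = 2d.
module Wave (e d : ℕ) .{{_ : ℕ.NonZero e}} where

  δ : ℕ → ℚ
  δ x = indicator (x % e ℕ.≟ 0)

  wave : ℕ → ℚ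
  wave x = δ x - δ (x ℕ.+ d)

  wave-cong : ∀ {x y} → x % e ≡ y % e → wave x ≡ wave y
  wave-cong {x} {y} x≡y = cong₂ (λ a b → indicator (a ℕ.≟ 0) - indicator (b ℕ.≟ 0)) x≡y $ begin
    (x ℕ.+ d) % e          ≡⟨ %-distribˡ-+ x d e ⟩
    (x % e ℕ.+ d % e) % e  ≡⟨ cong (λ z → (z ℕ.+ d % e) % e) x≡y ⟩
    (y % e ℕ.+ d % e) % e  ≡⟨ %-distribˡ-+ y d e ⟨
    (y ℕ.+ d) % e          ∎

  -- The multiples `j` and `k` witness a ≡ b modulo e without subtraction, in the shape that
  -- `complementary-shift` delivers.
  wave-+-cong : ∀ x {a b} j k → a ℕ.+ j ℕ.* e ≡ b ℕ.+ k ℕ.* e → wave (x ℕ.+ a) ≡ wave (x ℕ.+ b)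
  wave-+-cong x {a} {b} j k eq = wave-cong $ begin
    (x ℕ.+ a) % e                  ≡⟨ [m+kn]%n≡m%n (x ℕ.+ a) j e ⟨
    (x ℕ.+ a ℕ.+ j ℕ.* e) % e      ≡⟨ cong (_% e) (ℕ.+-assoc x a (j ℕ.* e)) ⟩
    (x ℕ.+ (a ℕ.+ j ℕ.* e)) % e    ≡⟨ cong (λ z → (x ℕ.+ z) % e) eq ⟩
    (x ℕ.+ (b ℕ.+ k ℕ.* e)) % e    ≡⟨ cong (_% e) (ℕ.+-assoc x b (k ℕ.* e)) ⟨
    (x ℕ.+ b ℕ.+ k ℕ.* e) % e      ≡⟨ [m+kn]%n≡m%n (x ℕ.+ b) k e ⟩
    (x ℕ.+ b) % e                  ∎

  -- Reduction modulo `n` does not change `wave`, because the period `e` divides `n`; thus `wave`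
  -- descends to ℤ/n.
  wave-⊕ : ∀ {n} .{{_ : ℕ.NonZero n}} → e ∣ n → ∀ (u : Fin n) a → wave (toℕ (u ⊕ a)) ≡ wave (toℕ u ℕ.+ a)
  wave-⊕ {n} e∣n u a = wave-cong $ begin
    toℕ (u ⊕ a) % e          ≡⟨ cong (_% e) (toℕ-⊕ u a) ⟩
    (toℕ u ℕ.+ a) % n % e    ≡⟨ m∣n⇒o%n%m≡o%m e n (toℕ u ℕ.+ a) e∣n ⟩
    (toℕ u ℕ.+ a) % e        ∎

  wave-0≢0 : 0 < d → d < e → wave 0 ≢ 0ℚ
  wave-0≢0 0<d d<e wave-0≡0 = contradiction (trans (sym wave-0≡1) wave-0≡0) λ ()
    where
    d%e≢0 : d % e ≢ 0
    d%e≢0 d%e≡0 = ℕ.<⇒≢ 0<d (sym (trans (sym (m<n⇒m%n≡m d<e)) d%e≡0))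

    wave-0≡1 : wave 0 ≡ 1ℚ
    wave-0≡1 = cong₂ (λ a b → (if a then 1ℚ else 0ℚ) - (if b then 1ℚ else 0ℚ))
      (dec-true (0 % e ℕ.≟ 0) (n∣m⇒m%n≡0 0 e (e ∣0))) (dec-false (d % e ℕ.≟ 0) d%e≢0)

  δ-+e : ∀ x → δ (x ℕ.+ e) ≡ δ x
  δ-+e x = cong (λ r → indicator (r ℕ.≟ 0)) ([m+n]%n≡m%n x e)

  wave-two-term : e ≡ d ℕ.+ d → ∀ x → wave x + wave (x ℕ.+ d) ≡ 0ℚ
  wave-two-term e≡2d x = begin
    (δ x - δ (x ℕ.+ d)) + (δ (x ℕ.+ d) - δ (x ℕ.+ d ℕ.+ d))
      ≡⟨ cong (λ y → (δ x - δ (x ℕ.+ d)) + (δ (x ℕ.+ d) - y))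
           (trans (cong δ (trans (ℕ.+-assoc x d d) (cong (x ℕ.+_) (sym e≡2d)))) (δ-+e x)) ⟩
    (δ x - δ (x ℕ.+ d)) + (δ (x ℕ.+ d) - δ x)
      ≡⟨ solve 2 (λ a b → (a :- b) :+ (b :- a) := con 0ℚ) refl (δ x) (δ (x ℕ.+ d)) ⟩
    0ℚ ∎

  wave-three-term : e ≡ d ℕ.+ (d ℕ.+ d) → ∀ x → wave x + (wave (x ℕ.+ d) + wave (x ℕ.+ (d ℕ.+ d))) ≡ 0ℚ
  wave-three-term e≡3d x = begin
    wave x + (wave (x ℕ.+ d) + (δ (x ℕ.+ (d ℕ.+ d)) - δ (x ℕ.+ (d ℕ.+ d) ℕ.+ d)))
      ≡⟨ cong₂ (λ y z → wave x + (wave (x ℕ.+ d) + (y - z)))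
           (cong δ (sym (ℕ.+-assoc x d d)))
           (trans (cong δ x+2d+d≡x+e) (δ-+e x)) ⟩
    (δ x - δ (x ℕ.+ d)) + ((δ (x ℕ.+ d) - δ (x ℕ.+ d ℕ.+ d)) + (δ (x ℕ.+ d ℕ.+ d) - δ x))
      ≡⟨ solve 3 (λ a b c → (a :- b) :+ ((b :- c) :+ (c :- a)) := con 0ℚ) refl
           (δ x) (δ (x ℕ.+ d)) (δ (x ℕ.+ d ℕ.+ d)) ⟩
    0ℚ ∎
    where
    x+2d+d≡x+e : x ℕ.+ (d ℕ.+ d) ℕ.+ d ≡ x ℕ.+ e
    x+2d+d≡x+e = trans (ℕ.+-assoc x (d ℕ.+ d) d) (cong (x ℕ.+_) (trans (ℕ.+-comm (d ℕ.+ d) d) (sym e≡3d)))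

-- Singularity of the complements, generic and antipodal.

module _ {n} .{{_ : ℕ.NonZero n}} (3≤n : 3 ≤ n) where

  module _ {i} (1≤i : 1 ≤ i) (2i<n : i ℕ.+ i < n) where
    private
      G : Graph n
      G = cycleDistanceGraph n i 3≤n 1≤i

      Ā : Matrix n
      Ā = adjacency (complement G)

      i≤n : i ≤ n
      i≤n = ℕ.≤-trans (ℕ.m≤m+n i i) (ℕ.<⇒≤ 2i<n)

    generic-rows : ∀ f u → (Ā ⊛ f) u + (f u + (f (u ⊕ i) + f (u ⊕ (n ∸ i)))) ≡ sum f
    generic-rows f u = trans
      (cong (λ x → (Ā ⊛ f) u + (f u + x)) (sym (two-neighbours-⊛ G f u (u ⊕ i) (u ⊕ (n ∸ i))
        (⊕i≢⊕[n∸i] 3≤n 1≤i 2i<n u) (distanceGraph-neighbours 3≤n 1≤i 2i<n u))))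
      (complement-⊛ G f u)

    3gcd∣n⇒singular : 3 ℕ.* gcd i n ∣ n → Singular (complement G)
    3gcd∣n⇒singular 3d∣n@(divides k n≡k3d) = kernel⇒singular Ā f 0F (λ u → begin
      (Ā ⊛ f) u                                                   ≡⟨ +-identityʳ _ ⟨
      (Ā ⊛ f) u + 0ℚ                                              ≡⟨ cong ((Ā ⊛ f) u +_) (three-term u) ⟨
      (Ā ⊛ f) u + (f u + (f (u ⊕ i) + f (u ⊕ (n ∸ i))))           ≡⟨ generic-rows f u ⟩
      sum f                                                       ≡⟨ sum-f≡0 ⟩
      0ℚ                                                          ∎)
      (λ f0F≡0 → wave-0≢0 (gcd>0 i n) d<3d (trans (cong wave (sym (toℕ-fromℕ< 0<n))) f0F≡0))
      where
      d e : ℕ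
      d = gcd i n
      e = 3 ℕ.* d

      0<n : 0 < n
      0<n = ℕ.≤-trans (s≤s z≤n) 3≤n

      0F : Fin n
      0F = fromℕ< 0<n

      d<3d : d < e
      d<3d = ℕ.m<m+n d (ℕ.≤-trans (gcd>0 i n) (ℕ.m≤m+n d _))

      instance
        e-nonZero : ℕ.NonZero e
        e-nonZero = ℕ.>-nonZero (ℕ.≤-<-trans z≤n d<3d)

      open Wave e d

      3d≡d+[d+d] : e ≡ d ℕ.+ (d ℕ.+ d)
      3d≡d+[d+d] = cong (λ x → d ℕ.+ (d ℕ.+ x)) (ℕ.+-identityʳ d)

      d+d+d≡3d : d ℕ.+ d ℕ.+ d ≡ e
      d+d+d≡3d = trans (ℕ.+-assoc d d d) (sym 3d≡d+[d+d])

      f : Vector ℚ n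
      f u = wave (toℕ u)

      f-⊕ : ∀ u {a b} j k → a ℕ.+ j ℕ.* e ≡ b ℕ.+ k ℕ.* e → f (u ⊕ a) ≡ wave (toℕ u ℕ.+ b)
      f-⊕ u {a} j k a≡b = trans (wave-⊕ 3d∣n u a) (wave-+-cong (toℕ u) j k a≡b)

      shifts : ∀ u → f (u ⊕ i) + f (u ⊕ (n ∸ i)) ≡ wave (toℕ u ℕ.+ d) + wave (toℕ u ℕ.+ (d ℕ.+ d))
      shifts u with i≡±gcd {i} {n} 3d∣n
      ... | r , inj₁ i≡d = cong₂ _+_
        (f-⊕ u 0 r (trans (ℕ.+-identityʳ i) i≡d))
        (f-⊕ u (1 ℕ.+ r) k (complementary-shift k r i≤n n≡k3d i≡d (sym 3d≡d+[d+d])))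
      -- Now `i` is -d modulo 3d, so the two neighbours exchange the offsets d and 2d.
      ... | r , inj₂ i≡d+d = trans (cong₂ _+_
        (f-⊕ u 0 r (trans (ℕ.+-identityʳ i) i≡d+d))
        (f-⊕ u (1 ℕ.+ r) k (complementary-shift k r i≤n n≡k3d i≡d+d d+d+d≡3d)))
        (+-comm (wave (toℕ u ℕ.+ (d ℕ.+ d))) (wave (toℕ u ℕ.+ d)))

      three-term : ∀ u → f u + (f (u ⊕ i) + f (u ⊕ (n ∸ i))) ≡ 0ℚ
      three-term u = trans (cong (f u +_) (shifts u)) (wave-three-term 3d≡d+[d+d] (toℕ u))

      sum-f≡0 : sum f ≡ 0ℚ
      sum-f≡0 = three-term⇒sum≡0 (_⊕ i) (_⊕ (n ∸ i))
        (⊕[n∸i]⊕i 3≤n 1≤i 2i<n) (⊕i⊕[n∸i] 3≤n 1≤i 2i<n) f three-term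

    -- If the divisibility fails, some M ≡ 2 modulo 3 has σ^M = 1, and every column of the identity
    -- can be solved for; by symmetry of the matrix this yields a two-sided inverse.
    singular⇒3gcd∣n : 4 ≤ n → Singular (complement G) → 3 ℕ.* gcd i n ∣ n
    singular⇒3gcd∣n 4≤n singular = decidable-stable (3 ℕ.* gcd i n ∣? n) λ 3d∤n →
      let q , n∣Mi = ∃multiple≡2mod3 {i} {n} 3d∤n in
      singular (symmetric-solvable⇒invertible Ā (adjacency-sym (complement G)) λ j →
        complement-solvable 4≤n Ā (_⊕ i) (_⊕ (n ∸ i)) generic-rows
          (three-term-solvable (_⊕ i) (_⊕ (n ∸ i)) (⊕[n∸i]⊕i 3≤n 1≤i 2i<n) q
            (λ u → trans (iterate-⊕ i (2 ℕ.+ q ℕ.* 3) u) (⊕-multiple u n∣Mi)))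
          (λ u → identity u j))

  module _ {i} (1≤i : 1 ≤ i) (2i≡n : i ℕ.+ i ≡ n) where
    private
      G : Graph n
      G = cycleDistanceGraph n i 3≤n 1≤i

      Ā : Matrix n
      Ā = adjacency (complement G)

    antipodal-singular : Singular (complement G)
    antipodal-singular = kernel⇒singular Ā f 0F (λ u → begin
      (Ā ⊛ f) u                              ≡⟨ +-identityʳ _ ⟨
      (Ā ⊛ f) u + 0ℚ                         ≡⟨ cong ((Ā ⊛ f) u +_) (two-term u) ⟨
      (Ā ⊛ f) u + (f u + f (u ⊕ i))          ≡⟨ cong (λ x → (Ā ⊛ f) u + (f u + x)) (one-neighbour-⊛ G f u (u ⊕ i)
                                                  (distanceGraph-neighbour 3≤n 1≤i 2i≡n u)) ⟨
      (Ā ⊛ f) u + (f u + (adjacency G ⊛ f) u) ≡⟨ complement-⊛ G f u ⟩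
      sum f                                  ≡⟨ two-term⇒sum≡0 (_⊕ i) (_⊕ i) ⊕i⊕i ⊕i⊕i f two-term ⟩
      0ℚ                                     ∎)
      (λ f0F≡0 → wave-0≢0 1≤i i<n (trans (cong wave (sym (toℕ-fromℕ< 0<n))) f0F≡0))
      where
      0<n : 0 < n
      0<n = ℕ.≤-trans (s≤s z≤n) 3≤n

      i<n : i < n
      i<n = subst (i <_) 2i≡n (ℕ.m<m+n i 1≤i)

      0F : Fin n
      0F = fromℕ< 0<n

      ⊕i⊕i : ∀ u → u ⊕ i ⊕ i ≡ u
      ⊕i⊕i u = ⊕-+≡n u 2i≡n

      -- With period n = 2i and offset i, `wave` on `Fin n` is 1 at 0, -1 at i and 0 elsewhere.
      open Wave n i

      f : Vector ℚ n
      f u = wave (toℕ u)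

      two-term : ∀ u → f u + f (u ⊕ i) ≡ 0ℚ
      two-term u = trans (cong (f u +_) (wave-⊕ ∣-refl u i)) (wave-two-term (sym 2i≡n) (toℕ u))

-- Parity of `n` and the two claims.

⌊n/2⌋-parity : ∀ n → n ≡ ⌊ n /2⌋ ℕ.+ ⌊ n /2⌋ ⊎ n ≡ 1 ℕ.+ (⌊ n /2⌋ ℕ.+ ⌊ n /2⌋)
⌊n/2⌋-parity 0 = inj₁ refl
⌊n/2⌋-parity 1 = inj₂ refl
⌊n/2⌋-parity (suc (suc n)) with ⌊n/2⌋-parity n
... | inj₁ eq = inj₁ (cong suc (trans (cong suc eq) (sym (ℕ.+-suc _ _))))
... | inj₂ eq = inj₂ (cong (2 ℕ.+_) (trans eq (sym (ℕ.+-suc _ _))))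

h+h≡2*h : ∀ h → h ℕ.+ h ≡ h ℕ.* 2
h+h≡2*h h = trans (cong (h ℕ.+_) (sym (ℕ.+-identityʳ h))) (ℕ.*-comm 2 h)

complement-singular⇔ : ∀ {n i} (4≤n : 4 ≤ n) (1≤i : 1 ≤ i) → i ℕ.+ i < n →
  Singular (complement (cycleDistanceGraph n i (4≤n⇒3≤n 4≤n) 1≤i)) ⇔ (3 ∣ n × gcd i n ∣ n / 3)
complement-singular⇔ {n} {i} 4≤n 1≤i 2i<n = mk⇔
  (λ s → Equivalence.from ∣×∣/⇔*∣ (singular⇒3gcd∣n 3≤n 1≤i 2i<n 4≤n s))
  (λ c → 3gcd∣n⇒singular 3≤n 1≤i 2i<n (Equivalence.to ∣×∣/⇔*∣ c))
  where
  3≤n : 3 ≤ n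
  3≤n = 4≤n⇒3≤n 4≤n

  instance
    n-nonZero : ℕ.NonZero n
    n-nonZero = ℕ.>-nonZero (ℕ.≤-trans (s≤s z≤n) 4≤n)

lemma15 : (n : ℕ) (4≤n : 4 ≤ n) →
    (Singular (complement (cycleDistanceGraph n ⌊ n /2⌋ (4≤n⇒3≤n 4≤n) (4≤n⇒1≤⌊n/2⌋ 4≤n)))
    ⇔ (2 ∣ n ⊎ n % 6 ≡ 3))
    ×
    ((i : ℕ) (1≤i : 1 ≤ i) → i < ⌊ n /2⌋ →
    Singular (complement (cycleDistanceGraph n i (4≤n⇒3≤n 4≤n) 1≤i))
    ⇔ (3 ∣ n × gcd i n ∣ n / 3))
lemma15 n 4≤n = antipodal (⌊n/2⌋-parity n) , λ i 1≤i i<h → complement-singular⇔ 4≤n 1≤i (2i<n i<h)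
  where
  h : ℕ
  h = ⌊ n /2⌋

  1≤h : 1 ≤ h
  1≤h = 4≤n⇒1≤⌊n/2⌋ 4≤n

  instance
    n-nonZero : ℕ.NonZero n
    n-nonZero = ℕ.>-nonZero (ℕ.≤-trans (s≤s z≤n) 4≤n)

  2i<n : ∀ {i} → i < h → i ℕ.+ i < n
  2i<n i<h = ℕ.<-≤-trans (ℕ.+-mono-< i<h i<h)
    (subst (h ℕ.+ h ≤_) (ℕ.⌊n/2⌋+⌈n/2⌉≡n n) (ℕ.+-monoʳ-≤ h (ℕ.⌊n/2⌋≤⌈n/2⌉ n)))

  antipodal : n ≡ h ℕ.+ h ⊎ n ≡ 1 ℕ.+ (h ℕ.+ h) →
    Singular (complement (cycleDistanceGraph n h (4≤n⇒3≤n 4≤n) 1≤h)) ⇔ (2 ∣ n ⊎ n % 6 ≡ 3)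
  antipodal (inj₁ n≡2h) = mk⇔ (λ _ → inj₁ (divides h (trans n≡2h (h+h≡2*h h))))
    (λ _ → antipodal-singular (4≤n⇒3≤n 4≤n) 1≤h (sym n≡2h))
  -- For n = 1 + 2h the inequality 2h < n is strict, so the generic criterion applies with i = h. As
  -- gcd(h, n) = 1, it reduces to 3 ∣ n, which for odd n is residue 3 modulo 6.
  antipodal (inj₂ n≡1+2h) = mk⇔
    (λ (3∣n , _) → inj₂ (Equivalence.to 3∣n⇔ 3∣n))
    (λ { (inj₁ 2∣n)   → contradiction 2∣n 2∤n
       ; (inj₂ n%6≡3) → Equivalence.from 3∣n⇔ n%6≡3 , ∣-trans gcd∣1 (1∣ (n / 3)) })
    ⇔-∘ complement-singular⇔ 4≤n 1≤h (subst (h ℕ.+ h <_) (sym n≡1+2h) ℕ.≤-refl)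
    where
    2∤n : ¬ 2 ∣ n
    2∤n 2∣n = contradiction (∣1⇒≡1 (∣m+n∣m⇒∣n
      (subst (2 ∣_) (trans n≡1+2h (ℕ.+-comm 1 (h ℕ.+ h))) 2∣n)
      (divides h (h+h≡2*h h)))) λ ()

    3∣n⇔ : 3 ∣ n ⇔ n % 6 ≡ 3
    3∣n⇔ = odd⇒3∣n⇔n%6≡3 n 2∤n

    gcd∣1 : gcd h n ∣ 1
    gcd∣1 = subst (λ m → gcd h m ∣ 1) (sym n≡1+2h) (gcd[h,1+h+h]∣1 h)
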